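{- Let $\mathit{Eng}$ be the engine CPS defined in the context. If $\mathit{Eng} \xrightarrow{\alpha_1} \cdots \xrightarrow{\alpha_n} \mathit{Eng}'$ for some $\mathit{Eng}'$, then $\alpha_i \in \{\tau, \mathsf{tick}\}$ for $1 \leq i \leq n$, and there is $\mathit{Eng}''$ such that $\mathit{Eng}' \xrightarrow{\alpha} \mathit{Eng}''$ for some $\alpha \in \{\tau, \mathsf{tick}\}$.
   Context: **Names and values.** There are sets of state variables $\mathcal{X}$, channels $\mathcal{C}$, actuators $\mathcal{A}$ and sensors $\mathcal{S}$. Values $v$ are built from basic values (Booleans, integers, real numbers) and also include names. For a set of names $\mathcal{N}$, $\mathbb{R}^{\mathcal{N}}$ is the set of functions $\mathcal{N}\to\mathbb{R}$, ordered pointwise; $\xi[n\mapsto v]$ is $\xi$ updated at $n$ to $v$. **Physical environment.** Given $\hat{\mathcal{X}}\subseteq\mathcal{X}$, $\hat{\mathcal{A}}\subseteq\mathcal{A}$, $\hat{\mathcal{S}}\subseteq\mathcal{S}$, a physical environment is a 7-tuple $E=\langle \xi_x,\xi_u,\xi_w,\mathit{evol},\xi_e,\mathit{meas},\mathit{inv}\rangle$ of total functions: state function $\xi_x\in\mathbb{R}^{\hat{\mathcal{X}}}$, actuator function $\xi_u\in\mathbb{R}^{\hat{\mathcal{A}}}$, uncertainty function $\xi_w\in\mathbb{R}^{\hat{\mathcal{X}}}$, evolution map $\mathit{evol}:\mathbb{R}^{\hat{\mathcal{X}}}\times\mathbb{R}^{\hat{\mathcal{A}}}\times\mathbb{R}^{\hat{\mathcal{X}}}\to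 2^{\mathbb{R}^{\hat{\mathcal{X}}}}$, sensor-error function $\xi_e\in\mathbb{R}^{\hat{\mathcal{S}}}$, measurement map $\mathit{meas}:\mathbb{R}^{\hat{\mathcal{X}}}\times\mathbb{R}^{\hat{\mathcal{S}}}\to 2^{\mathbb{R}^{\hat{\mathcal{S}}}}$, invariant function $\mathit{inv}:\mathbb{R}^{\hat{\mathcal{X}}}\to\{\mathsf{true},\mathsf{false}\}$. Operators: $\mathit{read\_sensor}(E,s)=\{\xi(s):\xi\in\mathit{meas}(\xi_x,\xi_e)\}$; $\mathit{update\_act}(E,a,v)$ is $E$ with $\xi_u$ replaced by $\xi_u[a\mapsto v]$; $\mathit{next}(E)$ is the set of environments obtained from $E$ by replacing $\xi_x$ with some $\xi\in\mathit{evol}(\xi_x,\xi_u,\xi_w)$; $\mathit{inv}(E)=\mathit{inv}(\xi_x)$. **Processes.** $P,Q ::= \mathsf{nil} \mid \mathsf{tick}.P \mid P\parallel Q \mid \lfloor\pi.P\rfloor Q \mid \mathsf{if}\,(b)\,\{P\}\,\mathsf{else}\,\{Q\} \mid P\setminus c \mid X \mid \mathsf{fix}\,X.P$, with prefixes $\pi$ among: $\overline{c}\langle v\rangle$ (send $v$ on channel $c$), $c(x)$ (receive on $c$), $\mathsf{read}\,s(x)$ (read sensor $s$), $\mathsf{write}\,a\langle v\rangle$ (write $v$ on actuator $a$). The variable $x$ is bound in $\lfloor c(x).P\rfloor Q$ and $\lfloor\mathsf{read}\,s(x).P\rfloor Q$ (with scope $P$), and $X$ is bound in $\mathsf{fix}\,X.P$;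 processes are taken up to $\alpha$-conversion and are closed (no free variables or process variables). In $\mathsf{tick}.Q$ and $\lfloor\pi.P\rfloor Q$ the occurrence of $Q$ is time-guarded; in $\mathsf{fix}\,X.P$ all occurrences of $X$ in $P$ must be time-guarded. Guards $b$ are decidable, and $\mathsf{if}\,(b)\,\{P\}\,\mathsf{else}\,\{Q\}$ is identified with $P$ if $b$ is true and with $Q$ if $b$ is false. $T\{v/x\}$ and $T\{P/X\}$ denote substitution. Abbreviations: $\pi.P$ stands for $\mathsf{fix}\,X.\lfloor\pi.P\rfloor X$ with $X$ not in $P$; $\mathsf{tick}^k.P$ is $k$ consecutive $\mathsf{tick}$ prefixes followed by $P$. **Process transitions** $P\xrightarrow{\lambda}P'$, $\lambda\in\{\mathsf{tick},\tau,\overline{c}v,cv,a!v,s?v\}$, are the least relation such that: $\lfloor\overline{c}\langle v\rangle.P\rfloor Q\xrightarrow{\overline{c}v}P$; $\lfloor c(x).P\rfloor Q\xrightarrow{cv}P\{v/x\}$; $\lfloor\mathsf{write}\,a\langle v\rangle.P\rfloor Q\xrightarrow{a!v}P$; $\lfloor\mathsf{read}\,s(x).P\rfloor Q\xrightarrow{s?v}P\{v/x\}$; if $P\xrightarrow{\overline{c}v}P'$ and $Q\xrightarrow{cv}Q'$ then $P\parallel Q\xrightarrow{\tau}P'\parallel Q'$ (and symmetrically); if $P\xrightarrow{\lambda}P'$ and $\lambda\ne\mathsf{tick}$ then $P\parallel Q\xrightarrow{\lambda}P'\parallel Q$ (and symmetrically); if $P\xrightarrow{\lambda}P'$ and $\lambda\notin\{cv,\overline{c}v\}$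 then $P\setminus c\xrightarrow{\lambda}P'\setminus c$; if $P\{\mathsf{fix}\,X.P/X\}\xrightarrow{\lambda}Q$ then $\mathsf{fix}\,X.P\xrightarrow{\lambda}Q$; $\mathsf{nil}\xrightarrow{\mathsf{tick}}\mathsf{nil}$; $\mathsf{tick}.P\xrightarrow{\mathsf{tick}}P$; $\lfloor\pi.P\rfloor Q\xrightarrow{\mathsf{tick}}Q$; if $P\xrightarrow{\mathsf{tick}}P'$, $Q\xrightarrow{\mathsf{tick}}Q'$ and $P\parallel Q$ has no $\tau$-transition then $P\parallel Q\xrightarrow{\mathsf{tick}}P'\parallel Q'$. **CPSs.** A CPS is $M=E\Join P$, always assumed well-formed: every sensor $s$ mentioned in $P$ is in the domain of $\xi_e$ and every actuator $a$ mentioned in $P$ is in the domain of $\xi_u$. Transitions $M\xrightarrow{\alpha}M'$, $\alpha\in\{\tau,\overline{c}v,cv,\mathsf{tick}\}$, all requiring $\mathit{inv}(E)=\mathsf{true}$: - $E\Join P\xrightarrow{\overline{c}v}E\Join P'$ if $P\xrightarrow{\overline{c}v}P'$; $E\Join P\xrightarrow{cv}E\Join P'$ if $P\xrightarrow{cv}P'$; - (SensRead) $E\Join P\xrightarrow{\tau}E\Join P'$ if $P\xrightarrow{s?v}P'$ and $v\in\mathit{read\_sensor}(E,s)$; - (ActWrite) $E\Join P\xrightarrow{\tau}\mathit{update\_act}(E,a,v)\Join P'$ if $P\xrightarrow{a!v}P'$; - (Tau) $E\Join P\xrightarrow{\tau}E\Join P'$ if $P\xrightarrow{\tau}P'$;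 - (Time) $E\Join P\xrightarrow{\mathsf{tick}}E'\Join P'$ if $P\xrightarrow{\mathsf{tick}}P'$, $E\Join P$ has no $\tau$-transition, and $E'\in\mathit{next}(E)$. **The engine.** $\mathit{Env}=\langle \xi_x,\xi_u,\xi_w,\mathit{evol},\xi_e,\mathit{meas},\mathit{inv}\rangle$ has one state variable $\mathit{temp}$, one actuator $\mathit{cool}$, one sensor $s_t$, and: $\xi_x(\mathit{temp})=0$; $\xi_u(\mathit{cool})=\mathsf{off}$ (actuator values are regarded as elements of $\{\mathsf{on},\mathsf{off}\}$, a real value $\ge0$ standing for $\mathsf{off}$ and $<0$ for $\mathsf{on}$); $\xi_w(\mathit{temp})=\delta=0.4$; $\mathit{evol}(\xi_x^i,\xi_u^i,\xi_w)=\{\xi:\xi(\mathit{temp})=\xi_x^i(\mathit{temp})+\mathit{heat}(\xi_u^i,\mathit{cool})+\gamma,\ \gamma\in[-\delta,+\delta]\}$, where $\mathit{heat}(\xi_u^i,\mathit{cool})=-1$ if $\xi_u^i(\mathit{cool})=\mathsf{on}$ and $+1$ if $\xi_u^i(\mathit{cool})=\mathsf{off}$; $\xi_e(s_t)=\epsilon=0.1$; $\mathit{meas}(\xi_x^i,\xi_e)=\{\xi:\xi(s_t)\in[\xi_x^i(\mathit{temp})-\epsilon,\xi_x^i(\mathit{temp})+\epsilon]\}$; $\mathit{inv}(\xi_x)=\mathsf{true}$ iff $0\le\xi_x(\mathit{temp})\le30$. The controller is $$\mathit{Ctrl}=\mathsf{fix}\,X.\,\mathsf{read}\,s_t(x).\,\mathsf{if}\,(x>10)\,\{\mathit{Cooling}\}\,\mathsf{else}\,\{\mathsf{tick}.X\},$$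 $$\mathit{Cooling}=\mathsf{write}\,\mathit{cool}\langle\mathsf{on}\rangle.\,\mathsf{fix}\,Y.\,\mathsf{tick}^5.\,\mathsf{read}\,s_t(x).\,\mathsf{if}\,(x>10)\,\{\overline{\mathit{warning}}\langle\mathrm{ID}\rangle.Y\}\,\mathsf{else}\,\{\mathsf{write}\,\mathit{cool}\langle\mathsf{off}\rangle.\mathsf{tick}.X\},$$ where $\mathit{warning}$ is a channel and $\mathrm{ID}$ a value (the engine identifier). $\mathit{Eng}=\mathit{Env}\Join\mathit{Ctrl}$. -}

module Defs where

open import Algebra.Bundles using (CommutativeRing)
import Algebra.Definitions.RawMonoid
open import Data.Bool.Base using (Bool; true; false; if_then_else_)
open import Data.Fin.Base using (Fin; zero; suc; _↑ʳ_)
import Data.Fin.Properties as Fin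
open import Data.Integer.Base using (ℤ)
open import Data.List.Base using (List; []; _∷_)
open import Data.Nat.Base using (ℕ; zero; suc; _+_)
open import Data.Product.Base using (Σ; ∃; _×_; _,_; proj₁)
open import Data.Unit.Base using (⊤)
open import Data.Vec.Base as Vec using (Vec; lookup; tabulate)
open import Level using (0ℓ)
open import Relation.Binary.Definitions using (Decidable; DecidableEquality)
open import Relation.Binary.PropositionalEquality using (_≡_; refl; _≢_)
open import Relation.Binary.Structures using (IsDecTotalOrder)
import Relation.Binary.Construct.NonStrictToStrict
open import Relation.Nullary using (¬_; does; _×-dec_)
open import Relation.Nullary.Decidable using (False)
open import Relation.Unary using (Pred; _∈_; ｛_｝)

-- The real numbers, as a complete ordered field.  Decidability of the order
-- is what makes guards and invariants Boolean-valued.  Completeness is stated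
-- for arbitrary predicates, so that a model requires classical logic.
record Reals : Set₁ where
  infix  4 _≤_ _<_
  infix  8 _⁻¹
  field
    commutativeRing : CommutativeRing 0ℓ 0ℓ

  open CommutativeRing commutativeRing public
    renaming (_+_ to _+ᴿ_; _*_ to _*ᴿ_; -_ to -ᴿ_)

  field
    _≤_             : Carrier → Carrier → Set
    isDecTotalOrder : IsDecTotalOrder _≈_ _≤_

  open IsDecTotalOrder isDecTotalOrder public
    using (_≟_; _≤?_)

  UpperBound : Pred Carrier 0ℓ → Pred Carrier 0ℓ
  UpperBound A u = ∀ {x} → x ∈ A → x ≤ u

  field
    0≉1         : ¬ (0# ≈ 1#)
    -- The value of 0# ⁻¹ is irrelevant.
    _⁻¹         : Carrier → Carrier
    *-inverseʳ  : ∀ x → ¬ (x ≈ 0#) → x *ᴿ x ⁻¹ ≈ 1#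
    +-monoˡ-≤   : ∀ {x y} z → x ≤ y → x +ᴿ z ≤ y +ᴿ z
    *-nonNeg    : ∀ {x y} → 0# ≤ x → 0# ≤ y → 0# ≤ x *ᴿ y
    supremum    : (A : Pred Carrier 0ℓ) → ∃ A → ∃ (UpperBound A) →
                  ∃ λ u → u ∈ UpperBound A × (∀ {v} → v ∈ UpperBound A → u ≤ v)

  _<_ : Carrier → Carrier → Set
  _<_ = Relation.Binary.Construct.NonStrictToStrict._<_ _≈_ _≤_

  _<?_ : Decidable _<_
  _<?_ = Relation.Binary.Construct.NonStrictToStrict.<-decidable _≈_ _≤_ _≟_ _≤?_

  fromℕ : ℕ → Carrier
  fromℕ n = Algebra.Definitions.RawMonoid._×_ +-rawMonoid n 1#

record Names : Set₁ where
  field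
    𝒳 𝒞 𝒜 𝒮 : Set        -- state variables, channels, actuators, sensors
    _≟ᴬ_     : DecidableEquality 𝒜   -- needed for ξu[a ↦ v]

module Calculus (reals : Reals) (names : Names) where

  open Reals reals
    using (_≈_; _≤_; _<_; _<?_; _≤?_; 0#; 1#; _+ᴿ_; -ᴿ_; fromℕ)
    renaming (Carrier to ℝ) public
  open Names names public

  data Value : Set where
    bool     : Bool → Value
    int      : ℤ → Value
    real     : ℝ → Value
    stateVar : 𝒳 → Value
    channel  : 𝒞 → Value
    actuator : 𝒜 → Value
    sensor   : 𝒮 → Value

  data Exp (n : ℕ) : Set where
    val : Value → Exp n
    var : Fin n → Exp n

  -- The concrete syntax of guards is left open: a guard is a decidable
  -- condition on the values of the variables in scope.
  Guard : ℕ → Set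
  Guard n = Vec Value n → Bool

  -- Prefix n b: a prefix over n value variables that binds b further ones.
  data Prefix (n : ℕ) : ℕ → Set where
    send  : 𝒞 → Exp n → Prefix n 0
    recv  : 𝒞 → Prefix n 1
    read  : 𝒮 → Prefix n 1
    write : 𝒜 → Exp n → Prefix n 0

  infixr 7 _∥_
  infixl 8 _∖_

  -- Proc k n: processes with free process variables in Fin k and free
  -- value variables in Fin n; closed processes are Proc 0 0.
  data Proc (k n : ℕ) : Set where
    nil   : Proc k n
    tick∙ : Proc k n → Proc k n
    _∥_   : Proc k n → Proc k n → Proc k n
    ⌊_∙_⌋_ : ∀ {b} → Prefix n b → Proc k (b + n) → Proc k n → Proc k n
    ifte  : Guard n → Proc k n → Proc k n → Proc k n
    _∖_   : Proc k n → 𝒞 → Proc k n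
    pvar  : Fin k → Proc k n
    fix   : Proc (suc k) n → Proc k n

  evalExp : ∀ {n} → Vec Value n → Exp n → Value
  evalExp η (val v) = v
  evalExp η (var i) = lookup η i

  substExp : ∀ {n m} → (Fin n → Exp m) → Exp n → Exp m
  substExp σ (val v) = val v
  substExp σ (var i) = σ i

  liftᵉ : ∀ {n m} b → (Fin n → Exp m) → Fin (b + n) → Exp (b + m)
  liftᵉ zero    σ i       = σ i
  liftᵉ (suc b) σ zero    = var zero
  liftᵉ (suc b) σ (suc i) = substExp (λ j → var (suc j)) (liftᵉ b σ i)

  substPrefix : ∀ {n m b} → (Fin n → Exp m) → Prefix n b → Prefix m b
  substPrefix σ (send c e)  = send c (substExp σ e)
  substPrefix σ (recv c)    = recv c
  substPrefix σ (read s)    = read s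
  substPrefix σ (write a e) = write a (substExp σ e)

  substGuard : ∀ {n m} → (Fin n → Exp m) → Guard n → Guard m
  substGuard σ g η = g (tabulate λ i → evalExp η (σ i))

  substVal : ∀ {k n m} → (Fin n → Exp m) → Proc k n → Proc k m
  substVal σ nil                  = nil
  substVal σ (tick∙ P)            = tick∙ (substVal σ P)
  substVal σ (P ∥ Q)              = substVal σ P ∥ substVal σ Q
  substVal σ (⌊_∙_⌋_ {b} π P Q)   =
    ⌊ substPrefix σ π ∙ substVal (liftᵉ b σ) P ⌋ substVal σ Q
  substVal σ (ifte g P Q)         = ifte (substGuard σ g) (substVal σ P) (substVal σ Q)
  substVal σ (P ∖ c)              = substVal σ P ∖ c
  substVal σ (pvar X)             = pvar X
  substVal σ (fix P)              = fix (substVal σ P)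

  liftʳ : ∀ {k l} → (Fin k → Fin l) → Fin (suc k) → Fin (suc l)
  liftʳ ρ zero    = zero
  liftʳ ρ (suc i) = suc (ρ i)

  renameProc : ∀ {k l n} → (Fin k → Fin l) → Proc k n → Proc l n
  renameProc ρ nil            = nil
  renameProc ρ (tick∙ P)      = tick∙ (renameProc ρ P)
  renameProc ρ (P ∥ Q)        = renameProc ρ P ∥ renameProc ρ Q
  renameProc ρ (⌊ π ∙ P ⌋ Q)  = ⌊ π ∙ renameProc ρ P ⌋ renameProc ρ Q
  renameProc ρ (ifte g P Q)   = ifte g (renameProc ρ P) (renameProc ρ Q)
  renameProc ρ (P ∖ c)        = renameProc ρ P ∖ c
  renameProc ρ (pvar X)       = pvar (ρ X)
  renameProc ρ (fix P)        = fix (renameProc (liftʳ ρ) P)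

  liftᵖ : ∀ {k l n} → (Fin k → Proc l n) → Fin (suc k) → Proc (suc l) n
  liftᵖ τ zero    = pvar zero
  liftᵖ τ (suc i) = renameProc suc (τ i)

  substProc : ∀ {k l n} → (Fin k → Proc l n) → Proc k n → Proc l n
  substProc τ nil                   = nil
  substProc τ (tick∙ P)             = tick∙ (substProc τ P)
  substProc τ (P ∥ Q)               = substProc τ P ∥ substProc τ Q
  substProc τ (⌊_∙_⌋_ {b} π P Q)    =
    ⌊ π ∙ substProc (λ X → substVal (λ i → var (b ↑ʳ i)) (τ X)) P ⌋ substProc τ Q
  substProc τ (ifte g P Q)          = ifte g (substProc τ P) (substProc τ Q)
  substProc τ (P ∖ c)               = substProc τ P ∖ c
  substProc τ (pvar X)              = τ X
  substProc τ (fix P)               = fix (substProc (liftᵖ τ) P)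

  infix 9 _[_]ᵛ _[_]ᵖ

  _[_]ᵛ : ∀ {k n} → Proc k (suc n) → Value → Proc k n
  P [ v ]ᵛ = substVal (λ { zero → val v ; (suc i) → var i }) P

  _[_]ᵖ : ∀ {k n} → Proc (suc k) n → Proc k n → Proc k n
  P [ Q ]ᵖ = substProc (λ { zero → Q ; (suc X) → pvar X }) P

  infixr 8 _∙_

  -- π.P, i.e. fix X.⌊π.P⌋X with X not in P.
  _∙_ : ∀ {k n b} → Prefix n b → Proc k (b + n) → Proc k n
  π ∙ P = fix (⌊ π ∙ renameProc suc P ⌋ pvar zero)

  tick^_∙_ : ∀ {k n} → ℕ → Proc k n → Proc k n
  tick^ zero  ∙ P = P
  tick^ suc m ∙ P = tick∙ (tick^ m ∙ P)

  -- Occurrences of X below a tick or in a timeout branch are time-guarded;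
  -- there must be no others.
  TimeGuarded : ∀ {k n} → Fin k → Proc k n → Set
  TimeGuarded X nil            = ⊤
  TimeGuarded X (tick∙ P)      = ⊤
  TimeGuarded X (P ∥ Q)        = TimeGuarded X P × TimeGuarded X Q
  TimeGuarded X (⌊ π ∙ P ⌋ Q)  = TimeGuarded X P
  TimeGuarded X (ifte g P Q)   = TimeGuarded X P × TimeGuarded X Q
  TimeGuarded X (P ∖ c)        = TimeGuarded X P
  TimeGuarded X (pvar Y)       = False (X Fin.≟ Y)
  TimeGuarded X (fix P)        = TimeGuarded (suc X) P

  GuardedFix : ∀ {k n} → Proc k n → Set
  GuardedFix nil            = ⊤
  GuardedFix (tick∙ P)      = GuardedFix P
  GuardedFix (P ∥ Q)        = GuardedFix P × GuardedFix Q
  GuardedFix (⌊ π ∙ P ⌋ Q)  = GuardedFix P × GuardedFix Q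
  GuardedFix (ifte g P Q)   = GuardedFix P × GuardedFix Q
  GuardedFix (P ∖ c)        = GuardedFix P
  GuardedFix (pvar X)       = ⊤
  GuardedFix (fix P)        = TimeGuarded zero P × GuardedFix P

  data Label : Set where
    tick τ  : Label
    out inp : 𝒞 → Value → Label
    wr      : 𝒜 → Value → Label
    rd      : 𝒮 → Value → Label

  infix 4 _-[_]→ᵘ_ _-tick→_ _-[_]→_

  -- The negative premise of the rule for tick and ∥ only concerns
  -- τ-transitions, so the relation is stratified: first the transitions
  -- with a label other than tick, then those labelled tick.  The rules
  -- for fix, ∖ and ifte occur in both strata.  The rules for ifte realise
  -- the identification of a conditional with the selected branch.
  data _-[_]→ᵘ_ : Proc 0 0 → Label → Proc 0 0 → Set where
    outp : ∀ {c v P Q} → ⌊ send c (val v) ∙ P ⌋ Q -[ out c v ]→ᵘ P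
    inpp : ∀ {c v P Q} → ⌊ recv c ∙ P ⌋ Q -[ inp c v ]→ᵘ P [ v ]ᵛ
    writ : ∀ {a v P Q} → ⌊ write a (val v) ∙ P ⌋ Q -[ wr a v ]→ᵘ P
    rea  : ∀ {s v P Q} → ⌊ read s ∙ P ⌋ Q -[ rd s v ]→ᵘ P [ v ]ᵛ
    comˡ : ∀ {c v P P′ Q Q′} → P -[ out c v ]→ᵘ P′ → Q -[ inp c v ]→ᵘ Q′ →
           P ∥ Q -[ τ ]→ᵘ P′ ∥ Q′
    comʳ : ∀ {c v P P′ Q Q′} → P -[ inp c v ]→ᵘ P′ → Q -[ out c v ]→ᵘ Q′ →
           P ∥ Q -[ τ ]→ᵘ P′ ∥ Q′
    parˡ : ∀ {λ′ P P′ Q} → P -[ λ′ ]→ᵘ P′ → P ∥ Q -[ λ′ ]→ᵘ P′ ∥ Q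
    parʳ : ∀ {λ′ P Q Q′} → Q -[ λ′ ]→ᵘ Q′ → P ∥ Q -[ λ′ ]→ᵘ P ∥ Q′
    res  : ∀ {λ′ c P P′} → P -[ λ′ ]→ᵘ P′ →
           (∀ v → λ′ ≢ inp c v) → (∀ v → λ′ ≢ out c v) →
           P ∖ c -[ λ′ ]→ᵘ P′ ∖ c
    rec  : ∀ {λ′ P Q} → P [ fix P ]ᵖ -[ λ′ ]→ᵘ Q → fix P -[ λ′ ]→ᵘ Q
    ifᵗ  : ∀ {λ′ g P P′ Q} → g Vec.[] ≡ true →
           P -[ λ′ ]→ᵘ P′ → ifte g P Q -[ λ′ ]→ᵘ P′
    ifᶠ  : ∀ {λ′ g P Q Q′} → g Vec.[] ≡ false →
           Q -[ λ′ ]→ᵘ Q′ → ifte g P Q -[ λ′ ]→ᵘ Q′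

  data _-tick→_ : Proc 0 0 → Proc 0 0 → Set where
    timeNil : nil -tick→ nil
    delay   : ∀ {P} → tick∙ P -tick→ P
    timeout : ∀ {b} {π : Prefix 0 b} {P Q} → ⌊ π ∙ P ⌋ Q -tick→ Q
    timePar : ∀ {P P′ Q Q′} → P -tick→ P′ → Q -tick→ Q′ →
              (∀ R → ¬ (P ∥ Q -[ τ ]→ᵘ R)) → P ∥ Q -tick→ P′ ∥ Q′
    res     : ∀ {c P P′} → P -tick→ P′ → P ∖ c -tick→ P′ ∖ c
    rec     : ∀ {P Q} → P [ fix P ]ᵖ -tick→ Q → fix P -tick→ Q
    ifᵗ     : ∀ {g P P′ Q} → g Vec.[] ≡ true → P -tick→ P′ → ifte g P Q -tick→ P′
    ifᶠ     : ∀ {g P Q Q′} → g Vec.[] ≡ false → Q -tick→ Q′ → ifte g P Q -tick→ Q′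

  data _-[_]→_ : Proc 0 0 → Label → Proc 0 0 → Set where
    untimed : ∀ {λ′ P P′} → P -[ λ′ ]→ᵘ P′ → P -[ λ′ ]→ P′
    timed   : ∀ {P P′} → P -tick→ P′ → P -[ tick ]→ P′

  -- ℝ^N for a subset N of some set of names.
  ℝ^ : {A : Set} → Pred A 0ℓ → Set
  ℝ^ N = Σ _ N → ℝ

  module _ (X̂ : Pred 𝒳 0ℓ) (Â : Pred 𝒜 0ℓ) (Ŝ : Pred 𝒮 0ℓ) where

    record Environment : Set₁ where
      field
        ξx   : ℝ^ X̂
        ξu   : ℝ^ Â
        ξw   : ℝ^ X̂
        evol : ℝ^ X̂ → ℝ^ Â → ℝ^ X̂ → Pred (ℝ^ X̂) 0ℓ
        ξe   : ℝ^ Ŝ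
        meas : ℝ^ X̂ → ℝ^ Ŝ → Pred (ℝ^ Ŝ) 0ℓ
        inv  : ℝ^ X̂ → Bool

    -- A sensor (actuator) is mentioned in a process if it occurs in a read
    -- (write) prefix; names transmitted as values do not count.
    WellFormedPrefix : ∀ {n b} → Prefix n b → Set
    WellFormedPrefix (send c e)  = ⊤
    WellFormedPrefix (recv c)    = ⊤
    WellFormedPrefix (read s)    = s ∈ Ŝ
    WellFormedPrefix (write a e) = a ∈ Â

    WellFormed : ∀ {k n} → Proc k n → Set
    WellFormed nil            = ⊤
    WellFormed (tick∙ P)      = WellFormed P
    WellFormed (P ∥ Q)        = WellFormed P × WellFormed Q
    WellFormed (⌊ π ∙ P ⌋ Q)  = WellFormedPrefix π × WellFormed P × WellFormed Q
    WellFormed (ifte g P Q)   = WellFormed P × WellFormed Q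
    WellFormed (P ∖ c)        = WellFormed P
    WellFormed (pvar X)       = ⊤
    WellFormed (fix P)        = WellFormed P

    record CPS : Set₁ where
      constructor cps
      field
        env        : Environment
        proc       : Proc 0 0
        guardedFix : GuardedFix proc
        wellFormed : WellFormed proc

  module _ {X̂ : Pred 𝒳 0ℓ} {Â : Pred 𝒜 0ℓ} {Ŝ : Pred 𝒮 0ℓ} where

    open Environment

    readSensor : Environment X̂ Â Ŝ → Σ 𝒮 Ŝ → Pred ℝ 0ℓ
    readSensor E s v = ∃ λ ξ → ξ ∈ meas E (ξx E) (ξe E) × v ≈ ξ s

    _[_↦_] : ℝ^ Â → 𝒜 → ℝ → ℝ^ Â
    (ξ [ a ↦ v ]) b = if does (proj₁ b ≟ᴬ a) then v else ξ b

    updateAct : Environment X̂ Â Ŝ → 𝒜 → ℝ → Environment X̂ Â Ŝ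
    updateAct E a v = record E { ξu = ξu E [ a ↦ v ] }

    next : Environment X̂ Â Ŝ → Pred (Environment X̂ Â Ŝ) _
    next E E′ = ∃ λ ξ → ξ ∈ evol E (ξx E) (ξu E) (ξw E) × E′ ≡ record E { ξx = ξ }

    invariant : Environment X̂ Â Ŝ → Bool
    invariant E = inv E (ξx E)

    data Action : Set where
      tick τ  : Action
      out inp : 𝒞 → Value → Action

    infix 4 _=[_]⇒ᵘ_ _=[_]⇒_ _=[_]⇒*_

    -- Stratified in the same way as the process transitions.  Sensors
    -- deliver and actuators accept real values only.
    data _=[_]⇒ᵘ_ : CPS X̂ Â Ŝ → Action → CPS X̂ Â Ŝ → Set₁ where
      outp      : ∀ {E P P′ g g′ w w′ c v} → invariant E ≡ true →
                  P -[ out c v ]→ P′ → cps E P g w =[ out c v ]⇒ᵘ cps E P′ g′ w′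
      inpp      : ∀ {E P P′ g g′ w w′ c v} → invariant E ≡ true →
                  P -[ inp c v ]→ P′ → cps E P g w =[ inp c v ]⇒ᵘ cps E P′ g′ w′
      sensRead  : ∀ {E P P′ g g′ w w′ s v} → invariant E ≡ true →
                  P -[ rd s (real v) ]→ P′ →
                  (s∈Ŝ : s ∈ Ŝ) → v ∈ readSensor E (s , s∈Ŝ) →
                  cps E P g w =[ τ ]⇒ᵘ cps E P′ g′ w′
      actWrite  : ∀ {E P P′ g g′ w w′ a v} → invariant E ≡ true →
                  P -[ wr a (real v) ]→ P′ →
                  cps E P g w =[ τ ]⇒ᵘ cps (updateAct E a v) P′ g′ w′
      tau       : ∀ {E P P′ g g′ w w′} → invariant E ≡ true →
                  P -[ τ ]→ P′ → cps E P g w =[ τ ]⇒ᵘ cps E P′ g′ w′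

    data _=[_]⇒_ : CPS X̂ Â Ŝ → Action → CPS X̂ Â Ŝ → Set₁ where
      untimed : ∀ {M α M′} → M =[ α ]⇒ᵘ M′ → M =[ α ]⇒ M′
      time    : ∀ {E E′ P P′ g g′ w w′} → invariant E ≡ true →
                P -[ tick ]→ P′ →
                (∀ M → ¬ (cps E P g w =[ τ ]⇒ᵘ M)) →
                E′ ∈ next E →
                cps E P g w =[ tick ]⇒ cps E′ P′ g′ w′

    data _=[_]⇒*_ : CPS X̂ Â Ŝ → List Action → CPS X̂ Â Ŝ → Set₁ where
      []  : ∀ {M} → M =[ [] ]⇒* M
      _∷_ : ∀ {M M′ M″ α αs} → M =[ α ]⇒ M′ → M′ =[ αs ]⇒* M″ →
            M =[ α ∷ αs ]⇒* M″

  -- The real numbers on and off encode the two actuator states; any on < 0 and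
  -- any off ≥ 0 are legitimate representatives.
  module Engine
    (temp : 𝒳) (cool : 𝒜) (sₜ : 𝒮) (warning : 𝒞) (ID : Value) (on off : ℝ)
    where

    open Reals reals using (_*ᴿ_; _⁻¹)

    _/10 : ℕ → ℝ
    n /10 = fromℕ n *ᴿ fromℕ 10 ⁻¹

    δ ε : ℝ
    δ = 4 /10
    ε = 1 /10

    temp̂ : Σ 𝒳 ｛ temp ｝
    temp̂ = temp , refl

    cool̂ : Σ 𝒜 ｛ cool ｝
    cool̂ = cool , refl

    ŝₜ : Σ 𝒮 ｛ sₜ ｝
    ŝₜ = sₜ , refl

    heat : ℝ^ ｛ cool ｝ → ℝ
    heat ξu = if does (ξu cool̂ <? 0#) then -ᴿ 1# else 1#

    Env : Environment ｛ temp ｝ ｛ cool ｝ ｛ sₜ ｝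
    Env = record
      { ξx   = λ _ → 0#
      ; ξu   = λ _ → off
      ; ξw   = λ _ → δ
      ; evol = λ ξx ξu ξw ξ →
                 ∃ λ γ → (-ᴿ δ ≤ γ × γ ≤ δ) × ξ temp̂ ≈ ξx temp̂ +ᴿ heat ξu +ᴿ γ
      ; ξe   = λ _ → ε
      ; meas = λ ξx ξe ξ → (ξx temp̂ +ᴿ -ᴿ ε ≤ ξ ŝₜ) × (ξ ŝₜ ≤ ξx temp̂ +ᴿ ε)
      ; inv  = λ ξx → does ((0# ≤? ξx temp̂) ×-dec (ξx temp̂ ≤? fromℕ 30))
      }

    -- Sensor readings, the only values tested, are always real.
    exceeds10 : Value → Bool
    exceeds10 (real r) = does (fromℕ 10 <? r)
    exceeds10 _        = false

    -- The guard x > 10 for the innermost variable x.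
    x>10 : ∀ {n} → Guard (suc n)
    x>10 η = exceeds10 (lookup η zero)

    -- Free process variable X (index 0, and index 1 below the binder of Y);
    -- the value variable is the reading that triggered the cooling.
    Cooling : Proc 1 1
    Cooling =
      write cool (val (real on)) ∙
      fix (tick^ 5 ∙
        (read sₜ ∙
          ifte x>10
            (send warning (val ID) ∙ pvar zero)
            (write cool (val (real off)) ∙ tick∙ (pvar (suc zero)))))

    Ctrl : Proc 0 0
    Ctrl = fix (read sₜ ∙ ifte x>10 Cooling (tick∙ (pvar zero)))

    Eng : CPS ｛ temp ｝ ｛ cool ｝ ｛ sₜ ｝
    Eng = cps Env Ctrl _
      (refl , ((refl , (refl , (_ , (refl , _)) , _) , _) , _) , _)

{-# OPTIONS --safe #-}

-- In tenths of a degree: every cooling cycle starts within [99, 115], since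
-- a reading above 10 means at least 99 and the last heating step started at
-- 101 or less.  Five cooling steps of 6 to 14 lead to [29, 85], where every
-- reading is at most 86; hence no warning is sent, and heating resumes far
-- from the limits 0 and 300.  Reads and writes are always possible and the
-- remaining control states can let time pass, so there is no deadlock.

module Submission where

open import Defs
import Algebra.Properties.CommutativeSemigroup as CommutativeSemigroup
import Algebra.Properties.Ring as RingProperties
import Algebra.Properties.Semiring.Mult as Multiples
open import Data.Bool.Base using (true; false)
open import Data.Fin.Base using (zero)
open import Data.List.Base using ([]; _∷_)
open import Data.List.Relation.Unary.All using (All; []; _∷_)
open import Data.Nat.Base as ℕ using (ℕ; zero; suc)
import Data.Nat.Properties as ℕ
open import Data.Nat.Tactic.RingSolver using (solve-∀)
open import Data.Product using (_×_; _,_; proj₁; proj₂; ∃; ∃-syntax)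
open import Data.Sum.Base using (inj₁; inj₂)
open import Level using (0ℓ)
open import Relation.Binary.Bundles using (Poset)
import Relation.Binary.Construct.NonStrictToStrict as Strict
open import Relation.Binary.PropositionalEquality as ≡ using (_≡_; refl)
import Relation.Binary.Reasoning.PartialOrder as PosetReasoning
open import Relation.Binary.Structures using (IsDecTotalOrder)
open import Relation.Nullary using (¬_; Dec; yes; no; contradiction)
open import Relation.Nullary.Decidable using (dec-true; dec-false; _×-dec_)
open import Relation.Unary using (Pred; _∈_; _∪_; ｛_｝)

-- Order and sign rules in an ordered field.

module OrderedField (reals : Reals) where

  open Reals reals hiding (refl)
  open IsDecTotalOrder isDecTotalOrder public
    using (total; antisym) renaming (refl to ≤-refl; reflexive to ≤-reflexive; trans to ≤-trans)
  open RingProperties ring using (-‿distribʳ-*; -‿involutive)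
  open Multiples semiring using (×-homo-+; ×1-homo-*)

  poset : Poset 0ℓ 0ℓ 0ℓ
  poset = record
    { isPartialOrder = IsDecTotalOrder.isPartialOrder isDecTotalOrder }

  open PosetReasoning poset

  +-monoʳ-≤ : ∀ x {y z} → y ≤ z → x +ᴿ y ≤ x +ᴿ z
  +-monoʳ-≤ x {y} {z} y≤z = begin
    x +ᴿ y  ≈⟨ +-comm x y ⟩
    y +ᴿ x  ≤⟨ +-monoˡ-≤ x y≤z ⟩
    z +ᴿ x  ≈⟨ +-comm z x ⟩
    x +ᴿ z  ∎

  x+y-y≈x : ∀ x y → x +ᴿ y +ᴿ -ᴿ y ≈ x
  x+y-y≈x x y = trans (+-assoc x y (-ᴿ y))
    (trans (+-congˡ (-‿inverseʳ y)) (+-identityʳ x))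

  x-y+y≈x : ∀ x y → x +ᴿ -ᴿ y +ᴿ y ≈ x
  x-y+y≈x x y = trans (+-assoc x (-ᴿ y) y)
    (trans (+-congˡ (-‿inverseˡ y)) (+-identityʳ x))

  x+y≤z⇒x≤z-y : ∀ {x y z} → x +ᴿ y ≤ z → x ≤ z +ᴿ -ᴿ y
  x+y≤z⇒x≤z-y {x} {y} {z} x+y≤z = begin
    x                  ≈⟨ x+y-y≈x x y ⟨
    x +ᴿ y +ᴿ -ᴿ y     ≤⟨ +-monoˡ-≤ (-ᴿ y) x+y≤z ⟩
    z +ᴿ -ᴿ y          ∎

  x≤z+y⇒x-y≤z : ∀ {x y z} → x ≤ z +ᴿ y → x +ᴿ -ᴿ y ≤ z
  x≤z+y⇒x-y≤z {x} {y} {z} x≤z+y = begin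
    x +ᴿ -ᴿ y          ≤⟨ +-monoˡ-≤ (-ᴿ y) x≤z+y ⟩
    z +ᴿ y +ᴿ -ᴿ y     ≈⟨ x+y-y≈x z y ⟩
    z                  ∎

  x-y≤z⇒x≤z+y : ∀ {x y z} → x +ᴿ -ᴿ y ≤ z → x ≤ z +ᴿ y
  x-y≤z⇒x≤z+y {x} {y} {z} x-y≤z = begin
    x                  ≈⟨ x-y+y≈x x y ⟨
    x +ᴿ -ᴿ y +ᴿ y     ≤⟨ +-monoˡ-≤ y x-y≤z ⟩
    z +ᴿ y             ∎

  nonPos⇒0≤- : ∀ {x} → x ≤ 0# → 0# ≤ -ᴿ x
  nonPos⇒0≤- {x} x≤0 = begin
    0#         ≤⟨ x+y≤z⇒x≤z-y (≤-trans (≤-reflexive (+-identityˡ x)) x≤0) ⟩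
    0# +ᴿ -ᴿ x ≈⟨ +-identityˡ (-ᴿ x) ⟩
    -ᴿ x       ∎

  nonNeg⇒-≤0 : ∀ {x} → 0# ≤ x → -ᴿ x ≤ 0#
  nonNeg⇒-≤0 {x} 0≤x = begin
    -ᴿ x       ≈⟨ +-identityˡ (-ᴿ x) ⟨
    0# +ᴿ -ᴿ x ≤⟨ x≤z+y⇒x-y≤z (≤-trans 0≤x (≤-reflexive (sym (+-identityˡ x)))) ⟩
    0#         ∎

  x≤x+y : ∀ x {y} → 0# ≤ y → x ≤ x +ᴿ y
  x≤x+y x {y} 0≤y = begin
    x        ≈⟨ +-identityʳ x ⟨
    x +ᴿ 0#  ≤⟨ +-monoʳ-≤ x 0≤y ⟩
    x +ᴿ y   ∎

  -- By totality of the order: if `1# ≤ 0#`, then `-ᴿ 1#` is nonnegative and so is its square, which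
  -- is `1#`.
  0≤1 : 0# ≤ 1#
  0≤1 with total 0# 1#
  ... | inj₁ 0≤1 = 0≤1
  ... | inj₂ 1≤0 = begin
    0#               ≤⟨ *-nonNeg 0≤-1 0≤-1 ⟩
    -ᴿ 1# *ᴿ -ᴿ 1#   ≈⟨ -‿distribʳ-* (-ᴿ 1#) 1# ⟨
    -ᴿ (-ᴿ 1# *ᴿ 1#) ≈⟨ -‿cong (*-identityʳ (-ᴿ 1#)) ⟩
    -ᴿ (-ᴿ 1#)       ≈⟨ -‿involutive 1# ⟩
    1#               ∎
    where
    0≤-1 : 0# ≤ -ᴿ 1#
    0≤-1 = nonPos⇒0≤- 1≤0

  -- A nonpositive inverse would make `x *ᴿ -ᴿ (x ⁻¹)`, that is `-ᴿ 1#`, nonnegative, and then `0#`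
  -- and `1#` would coincide.
  ⁻¹-nonNeg : ∀ {x} → 0# ≤ x → ¬ (x ≈ 0#) → 0# ≤ x ⁻¹
  ⁻¹-nonNeg {x} 0≤x x≉0 with total 0# (x ⁻¹)
  ... | inj₁ 0≤x⁻¹ = 0≤x⁻¹
  ... | inj₂ x⁻¹≤0 = contradiction (antisym 0≤1 1≤0) 0≉1
    where
    0≤-1 : 0# ≤ -ᴿ 1#
    0≤-1 = begin
      0#                ≤⟨ *-nonNeg 0≤x (nonPos⇒0≤- x⁻¹≤0) ⟩
      x *ᴿ -ᴿ (x ⁻¹)    ≈⟨ -‿distribʳ-* x (x ⁻¹) ⟨
      -ᴿ (x *ᴿ x ⁻¹)    ≈⟨ -‿cong (*-inverseʳ x x≉0) ⟩
      -ᴿ 1#             ∎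
    1≤0 : 1# ≤ 0#
    1≤0 = begin
      1#          ≈⟨ -‿involutive 1# ⟨
      -ᴿ (-ᴿ 1#)  ≤⟨ nonNeg⇒-≤0 0≤-1 ⟩
      0#          ∎

  fromℕ-nonNeg : ∀ n → 0# ≤ fromℕ n
  fromℕ-nonNeg zero    = ≤-refl
  fromℕ-nonNeg (suc n) = ≤-trans 0≤1 (x≤x+y 1# (fromℕ-nonNeg n))

  fromℕ-suc≉0 : ∀ n → ¬ (fromℕ (suc n) ≈ 0#)
  fromℕ-suc≉0 n eq = 0≉1 (antisym 0≤1
    (≤-trans (x≤x+y 1# (fromℕ-nonNeg n)) (≤-reflexive eq)))

  -- Fractions with natural numerators and a fixed denominator.

  infixl 7 _⟋_

  -- With m = 9 this is n /10; m is the predecessor of the denominator.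
  _⟋_ : ℕ → ℕ → Carrier
  n ⟋ m = fromℕ n *ᴿ fromℕ (suc m) ⁻¹

  ⟋-+ : ∀ m n k → (m ℕ.+ n) ⟋ k ≈ m ⟋ k +ᴿ n ⟋ k
  ⟋-+ m n k = trans (*-congʳ (×-homo-+ 1# m n)) (distribʳ _ _ _)

  ⟋-nonNeg : ∀ n k → 0# ≤ n ⟋ k
  ⟋-nonNeg n k = *-nonNeg (fromℕ-nonNeg n) (⁻¹-nonNeg (fromℕ-nonNeg (suc k)) (fromℕ-suc≉0 k))

  ⟋-mono-≤ : ∀ {m n} k → m ℕ.≤ n → m ⟋ k ≤ n ⟋ k
  ⟋-mono-≤ {m} {n} k m≤n = begin
    m ⟋ k                     ≤⟨ x≤x+y (m ⟋ k) (⟋-nonNeg (n ℕ.∸ m) k) ⟩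
    m ⟋ k +ᴿ (n ℕ.∸ m) ⟋ k    ≈⟨ ⟋-+ m (n ℕ.∸ m) k ⟨
    (m ℕ.+ (n ℕ.∸ m)) ⟋ k     ≡⟨ ≡.cong (_⟋ k) (ℕ.m+[n∸m]≡n m≤n) ⟩
    n ⟋ k                     ∎

  ⟋-cancel : ∀ n k → (n ℕ.* suc k) ⟋ k ≈ fromℕ n
  ⟋-cancel n k = trans (*-congʳ (×1-homo-* n (suc k)))
    (trans (*-assoc _ _ _)
    (trans (*-congˡ (*-inverseʳ _ (fromℕ-suc≉0 k))) (*-identityʳ _)))

  ≮⇒≥ : ∀ {x y} → ¬ (x < y) → y ≤ x
  ≮⇒≥ = Strict.≮⇒≥ _≈_ _≤_ sym _≟_ ≤-reflexive total

module EngineSafety (reals : Reals) (names : Names)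
  (temp : Names.𝒳 names) (cool : Names.𝒜 names) (sₜ : Names.𝒮 names)
  (warning : Names.𝒞 names) (ID : Calculus.Value reals names)
  (on off : Reals.Carrier reals)
  (on<0 : Reals._<_ reals on (Reals.0# reals))
  (0≤off : Reals._≤_ reals (Reals.0# reals) off)
  where

  open Calculus reals names
  open Engine temp cool sₜ warning ID on off
  open Reals reals
    using (trans; sym; +-congˡ; +-congʳ; +-identityʳ; +-commutativeSemigroup; +-monoˡ-≤)
    renaming (refl to ≈-refl)
  open OrderedField reals
  open CommutativeSemigroup +-commutativeSemigroup using (xy∙z≈xz∙y)
  open PosetReasoning poset

  -- Temperature intervals in tenths of a degree.

  infix 4 _∈[_,_]

  -- With natural numbers of tenths as bounds, comparing bounds becomes arithmetic in `ℕ`, settled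
  -- by evaluation on literals. Being a record, it lets the bounds be inferred from the type.
  record _∈[_,_] (x : ℝ) (m n : ℕ) : Set where
    constructor _,_
    field
      lower : m /10 ≤ x
      upper : x ≤ n /10

  open _∈[_,_]

  ∈-⊆ : ∀ {x m n m′ n′} → m′ ℕ.≤ m → n ℕ.≤ n′ → x ∈[ m , n ] → x ∈[ m′ , n′ ]
  ∈-⊆ m′≤m n≤n′ (m≤x , x≤n) = ≤-trans (⟋-mono-≤ 9 m′≤m) m≤x , ≤-trans x≤n (⟋-mono-≤ 9 n≤n′)

  1≈10/10 : 1# ≈ 10 /10
  -- `fromℕ 1` unfolds to `1# +ᴿ 0#`, hence the identity law.
  1≈10/10 = trans (sym (+-identityʳ 1#)) (sym (⟋-cancel 1 9))

  -- The extreme cases `γ = -ᴿ δ` and `γ = δ` bound all the others, so checking the two ends is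
  -- enough.
  perturb : ∀ {t h γ a b} → -ᴿ δ ≤ γ × γ ≤ δ →
            a /10 +ᴿ δ ≤ t +ᴿ h → t +ᴿ h +ᴿ δ ≤ b /10 →
            t +ᴿ h +ᴿ γ ∈[ a , b ]
  perturb {t} {h} (-δ≤γ , γ≤δ) a+δ≤ ≤b =
    ≤-trans (x+y≤z⇒x≤z-y a+δ≤) (+-monoʳ-≤ (t +ᴿ h) -δ≤γ) ,
    ≤-trans (+-monoʳ-≤ (t +ᴿ h) γ≤δ) ≤b

  -- A heating step adds 10 tenths, give or take 4, so it maps `[m, n]` into `[m + 6, n + 14]`. The
  -- side conditions keep all terms additive and so avoid truncated subtraction.
  heated : ∀ {t γ m n} a b → a ℕ.+ 4 ℕ.≤ m ℕ.+ 10 → n ℕ.+ 10 ℕ.+ 4 ℕ.≤ b →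
           -ᴿ δ ≤ γ × γ ≤ δ → t ∈[ m , n ] → t +ᴿ 1# +ᴿ γ ∈[ a , b ]
  heated {t} {γ} {m} {n} a b a≤ ≤b γ∈ (m≤t , t≤n) = perturb γ∈
    (begin
      a /10 +ᴿ δ           ≈⟨ ⟋-+ a 4 9 ⟨
      (a ℕ.+ 4) /10        ≤⟨ ⟋-mono-≤ 9 a≤ ⟩
      (m ℕ.+ 10) /10       ≈⟨ ⟋-+ m 10 9 ⟩
      m /10 +ᴿ 10 /10      ≈⟨ +-congˡ 1≈10/10 ⟨
      m /10 +ᴿ 1#          ≤⟨ +-monoˡ-≤ 1# m≤t ⟩
      t +ᴿ 1#              ∎)
    (begin
      t +ᴿ 1# +ᴿ δ             ≤⟨ +-monoˡ-≤ δ (+-monoˡ-≤ 1# t≤n) ⟩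
      n /10 +ᴿ 1# +ᴿ δ         ≈⟨ +-congʳ (+-congˡ 1≈10/10) ⟩
      n /10 +ᴿ 10 /10 +ᴿ δ     ≈⟨ +-congʳ (⟋-+ n 10 9) ⟨
      (n ℕ.+ 10) /10 +ᴿ δ      ≈⟨ ⟋-+ (n ℕ.+ 10) 4 9 ⟨
      (n ℕ.+ 10 ℕ.+ 4) /10     ≤⟨ ⟋-mono-≤ 9 ≤b ⟩
      b /10                    ∎)

  -- A cooling step removes between 6 and 14 tenths; the side conditions are again subtraction-free.
  cooled : ∀ {t γ m n} a b → a ℕ.+ 4 ℕ.+ 10 ℕ.≤ m → n ℕ.+ 4 ℕ.≤ b ℕ.+ 10 →
           -ᴿ δ ≤ γ × γ ≤ δ → t ∈[ m , n ] → t +ᴿ -ᴿ 1# +ᴿ γ ∈[ a , b ]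
  cooled {t} {γ} {m} {n} a b a≤ ≤b γ∈ (m≤t , t≤n) = perturb γ∈
    (x+y≤z⇒x≤z-y (begin
      a /10 +ᴿ δ +ᴿ 1#         ≈⟨ +-congʳ (⟋-+ a 4 9) ⟨
      (a ℕ.+ 4) /10 +ᴿ 1#      ≈⟨ +-congˡ 1≈10/10 ⟩
      (a ℕ.+ 4) /10 +ᴿ 10 /10  ≈⟨ ⟋-+ (a ℕ.+ 4) 10 9 ⟨
      (a ℕ.+ 4 ℕ.+ 10) /10     ≤⟨ ⟋-mono-≤ 9 a≤ ⟩
      m /10                    ≤⟨ m≤t ⟩
      t                        ∎))
    (begin
      t +ᴿ -ᴿ 1# +ᴿ δ          ≈⟨ xy∙z≈xz∙y t (-ᴿ 1#) δ ⟩
      t +ᴿ δ +ᴿ -ᴿ 1#          ≤⟨ x≤z+y⇒x-y≤z t+δ≤b+1 ⟩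
      b /10                    ∎)
    where
    t+δ≤b+1 : t +ᴿ δ ≤ b /10 +ᴿ 1#
    t+δ≤b+1 = begin
      t +ᴿ δ             ≤⟨ +-monoˡ-≤ δ t≤n ⟩
      n /10 +ᴿ δ         ≈⟨ ⟋-+ n 4 9 ⟨
      (n ℕ.+ 4) /10      ≤⟨ ⟋-mono-≤ 9 ≤b ⟩
      (b ℕ.+ 10) /10     ≈⟨ ⟋-+ b 10 9 ⟩
      b /10 +ᴿ 10 /10    ≈⟨ +-congˡ 1≈10/10 ⟨
      b /10 +ᴿ 1#        ∎

  -- Controller states and their transitions.

  -- Unfolding a `fix` puts closed processes under binders. On the concrete processes used here,
  -- `weaken` evaluates to the very term that substitution leaves there, so residuals can be
  -- identified by `refl`.
  weaken : ∀ {k n} → Proc 0 0 → Proc k n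
  weaken P = substVal (λ ()) (renameProc (λ ()) P)

  restart : ∀ {k n} → Proc k n
  restart = write cool (val (real off)) ∙ tick∙ (weaken Ctrl)

  monitor : Proc 0 0
  monitor = fix (tick^ 5 ∙ (read sₜ ∙ ifte x>10 (send warning (val ID) ∙ pvar zero) restart))

  recheck : Proc 0 0
  recheck = read sₜ ∙ ifte x>10 (send warning (val ID) ∙ weaken monitor) restart

  -- What remains after the first and after a later reading: the value has been substituted into the
  -- guard, which is thereby constant.
  decide decideAgain : Value → Proc 0 0
  decide v = ifte (λ _ → exceeds10 v) (write cool (val (real on)) ∙ monitor) (tick∙ Ctrl)
  decideAgain v = ifte (λ _ → exceeds10 v) (send warning (val ID) ∙ monitor) restart

  -- `Reader`, `Writer` and `Waiter` are the three shapes of a controller state. In each, `step`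
  -- serves progress and `only` serves preservation. Timeouts of readers and writers are left to the
  -- CPS level, where an available τ-transition blocks time.
  record Reader (P : Proc 0 0) (K : Value → Proc 0 0) : Set where
    field
      step : ∀ v → P -[ rd sₜ v ]→ᵘ K v
      only : ∀ {l R} → P -[ l ]→ᵘ R → ∃ λ v → l ≡ rd sₜ v × R ≡ K v

  record Writer (P : Proc 0 0) (r : ℝ) (Q : Proc 0 0) : Set where
    field
      step : P -[ wr cool (real r) ]→ᵘ Q
      only : ∀ {l R} → P -[ l ]→ᵘ R → l ≡ wr cool (real r) × R ≡ Q

  record Waiter (P Q : Proc 0 0) : Set where
    field
      quiet : ∀ {l R} → ¬ (P -[ l ]→ᵘ R)
      step  : P -tick→ Q
      only  : ∀ {R} → P -tick→ R → R ≡ Q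

  Ctrl-reads : Reader Ctrl decide
  Ctrl-reads = record
    { step = λ _ → rec (rec rea)
    ; only = λ { (rec (rec rea)) → _ , refl , refl }
    }

  recheck-reads : Reader recheck decideAgain
  recheck-reads = record
    { step = λ _ → rec rea
    ; only = λ { (rec rea) → _ , refl , refl }
    }

  monitor-waits : Waiter monitor (tick^ 4 ∙ recheck)
  monitor-waits = record
    { quiet = λ { (rec ()) }
    ; step  = rec delay
    ; only  = λ { (rec delay) → refl }
    }

  tick-waits : ∀ {P} → Waiter (tick∙ P) P
  tick-waits = record
    { quiet = λ ()
    ; step  = delay
    ; only  = λ { delay → refl }
    }

  decide-hot : ∀ {v} → exceeds10 v ≡ true → Writer (decide v) on monitor
  decide-hot hot = record
    { step = ifᵗ hot (rec writ)
    ; only = λ { (ifᵗ _ (rec writ)) → refl , refl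
               ; (ifᶠ cold _) → contradiction (≡.trans (≡.sym hot) cold) λ () }
    }

  decide-cold : ∀ {v} → exceeds10 v ≡ false → Waiter (decide v) Ctrl
  decide-cold cold = record
    { quiet = λ { (ifᵗ hot _) → contradiction (≡.trans (≡.sym hot) cold) λ () }
    ; step  = ifᶠ cold delay
    ; only  = λ { (ifᵗ hot _) → contradiction (≡.trans (≡.sym hot) cold) λ ()
                ; (ifᶠ _ delay) → refl }
    }

  -- Only the cold case is treated: `cooled⇒cold` rules out a hot reading after five cooling steps,
  -- so the warning branch is never entered.
  decideAgain-cold : ∀ {v} → exceeds10 v ≡ false → Writer (decideAgain v) off (tick∙ Ctrl)
  decideAgain-cold cold = record
    { step = ifᶠ cold (rec writ)
    ; only = λ { (ifᵗ hot _) → contradiction (≡.trans (≡.sym hot) cold) λ ()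
               ; (ifᶠ _ (rec writ)) → refl , refl }
    }

  -- Engine states and the phases of the control cycle.

  EngineCPS : Set₁
  EngineCPS = CPS ｛ temp ｝ ｛ cool ｝ ｛ sₜ ｝

  engine : ℝ^ ｛ temp ｝ → ℝ^ ｛ cool ｝ → Environment ｛ temp ｝ ｛ cool ｝ ｛ sₜ ｝
  engine ξ u = record Env { ξx = ξ ; ξu = u }

  evolutions : ℝ^ ｛ temp ｝ → ℝ^ ｛ cool ｝ → Pred (ℝ^ ｛ temp ｝) 0ℓ
  evolutions ξ u = Environment.evol Env ξ u (λ _ → δ)

  setCool : ℝ^ ｛ cool ｝ → ℝ → ℝ^ ｛ cool ｝
  setCool u r = _[_↦_] {｛ temp ｝} {｛ cool ｝} {｛ sₜ ｝} u cool r

  setCool-cool : ∀ u r → setCool u r cool̂ ≡ r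
  setCool-cool u r rewrite dec-true (cool ≟ᴬ cool) refl = refl

  heat-on : ∀ u → u cool̂ ≡ on → heat u ≡ -ᴿ 1#
  heat-on u eq rewrite eq | dec-true (on <? 0#) on<0 = refl

  off≮0 : ¬ (off < 0#)
  off≮0 (off≤0 , off≉0) = off≉0 (antisym off≤0 0≤off)

  heat-off : ∀ u → u cool̂ ≡ off → heat u ≡ 1#
  heat-off u eq rewrite eq | dec-false (off <? 0#) off≮0 = refl

  -- In cooling k, k ticks remain before the next reading; monitor is kept
  -- apart, being a fix rather than tick^ 5 ∙ recheck.
  data Phase : ℝ^ ｛ temp ｝ → ℝ^ ｛ cool ｝ → Proc 0 0 → Set where
    sensing   : ∀ {ξ u} → heat u ≡ 1# → ξ temp̂ ∈[ 0 , 115 ] → Phase ξ u Ctrl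
    deciding  : ∀ {ξ u v} → heat u ≡ 1# → ξ temp̂ ∈[ 0 , 115 ] →
                ξ temp̂ +ᴿ -ᴿ ε ≤ v × v ≤ ξ temp̂ +ᴿ ε →
                Phase ξ u (decide (real v))
    cooling₅  : ∀ {ξ u} → heat u ≡ -ᴿ 1# → ξ temp̂ ∈[ 99 , 115 ] → Phase ξ u monitor
    cooling   : ∀ {ξ u} k → k ℕ.≤ 4 → heat u ≡ -ᴿ 1# →
                ξ temp̂ ∈[ k ℕ.* 14 ℕ.+ 29 , k ℕ.* 6 ℕ.+ 85 ] →
                Phase ξ u (tick^ k ∙ recheck)
    rechecked : ∀ {ξ u v} → ξ temp̂ ∈[ 29 , 85 ] → v ≤ ξ temp̂ +ᴿ ε →
                Phase ξ u (decideAgain (real v))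
    resuming  : ∀ {ξ u} → heat u ≡ 1# → ξ temp̂ ∈[ 0 , 101 ] → Phase ξ u (tick∙ Ctrl)

  -- Joins the shape of the controller with the phases of all its successors, so that a single case
  -- analysis on phases feeds both progress and preservation.
  data Enabled (ξ : ℝ^ ｛ temp ｝) (u : ℝ^ ｛ cool ｝) (P : Proc 0 0) : Set where
    reading : ∀ {K} → Reader P K →
              (∀ {v} → v ∈ readSensor (engine ξ u) ŝₜ → Phase ξ u (K (real v))) →
              Enabled ξ u P
    writing : ∀ {r Q} → Writer P r Q → Phase ξ (setCool u r) Q → Enabled ξ u P
    waiting : ∀ {Q} → Waiter P Q →
              (∀ {ξ′} → ξ′ ∈ evolutions ξ u → Phase ξ′ u Q) →
              Enabled ξ u P

  -- Every phase leads to phases.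

  ∈-resp-≈ : ∀ {x y m n} → x ≈ y → y ∈[ m , n ] → x ∈[ m , n ]
  ∈-resp-≈ x≈y (m≤y , y≤n) =
    ≤-trans m≤y (≤-reflexive (sym x≈y)) , ≤-trans (≤-reflexive x≈y) y≤n

  next-heated : ∀ ξ u {Q m n} a b → a ℕ.+ 4 ℕ.≤ m ℕ.+ 10 → n ℕ.+ 10 ℕ.+ 4 ℕ.≤ b →
    heat u ≡ 1# → ξ temp̂ ∈[ m , n ] →
    (∀ {ξ′} → ξ′ temp̂ ∈[ a , b ] → Phase ξ′ u Q) →
    ∀ {ξ′} → ξ′ ∈ evolutions ξ u → Phase ξ′ u Q
  next-heated _ _ a b a≤ ≤b heat≡ t∈ phase (γ , γ∈ , eq) rewrite heat≡ =
    phase (∈-resp-≈ eq (heated a b a≤ ≤b γ∈ t∈))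

  next-cooled : ∀ ξ u {Q m n} a b → a ℕ.+ 4 ℕ.+ 10 ℕ.≤ m → n ℕ.+ 4 ℕ.≤ b ℕ.+ 10 →
    heat u ≡ -ᴿ 1# → ξ temp̂ ∈[ m , n ] →
    (∀ {ξ′} → ξ′ temp̂ ∈[ a , b ] → Phase ξ′ u Q) →
    ∀ {ξ′} → ξ′ ∈ evolutions ξ u → Phase ξ′ u Q
  next-cooled _ _ a b a≤ ≤b heat≡ t∈ phase (γ , γ∈ , eq) rewrite heat≡ =
    phase (∈-resp-≈ eq (cooled a b a≤ ≤b γ∈ t∈))

  -- The sensor overstates the temperature by at most one tenth.
  hot⇒ : ∀ {t v} → v ≤ t +ᴿ ε → fromℕ 10 ≤ v → 99 /10 ≤ t
  hot⇒ {t} {v} v≤t+ε 10≤v = begin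
    99 /10                ≤⟨ x+y≤z⇒x≤z-y (≤-reflexive 99/10+ε≈10) ⟩
    fromℕ 10 +ᴿ -ᴿ ε      ≤⟨ x≤z+y⇒x-y≤z (≤-trans 10≤v v≤t+ε) ⟩
    t                     ∎
    where
    99/10+ε≈10 : 99 /10 +ᴿ ε ≈ fromℕ 10
    99/10+ε≈10 = trans (sym (⟋-+ 99 1 9)) (⟋-cancel 10 9)

  -- The sensor understates the temperature by at most one tenth.
  cold⇒ : ∀ {t v} → t +ᴿ -ᴿ ε ≤ v → v ≤ fromℕ 10 → t ≤ 101 /10
  cold⇒ {t} {v} t-ε≤v v≤10 = begin
    t                     ≤⟨ x-y≤z⇒x≤z+y (≤-trans t-ε≤v v≤10) ⟩
    fromℕ 10 +ᴿ ε         ≈⟨ +-congʳ (⟋-cancel 10 9) ⟨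
    100 /10 +ᴿ ε          ≈⟨ ⟋-+ 100 1 9 ⟨
    101 /10               ∎

  cooled⇒cold : ∀ {t v} → t ≤ 85 /10 → v ≤ t +ᴿ ε → ¬ (fromℕ 10 < v)
  cooled⇒cold {t} {v} t≤ v≤ (10≤v , 10≉v) = 10≉v (antisym 10≤v (begin
    v               ≤⟨ v≤ ⟩
    t +ᴿ ε          ≤⟨ +-monoˡ-≤ ε t≤ ⟩
    85 /10 +ᴿ ε     ≈⟨ ⟋-+ 85 1 9 ⟨
    86 /10          ≤⟨ ⟋-mono-≤ 9 (ℕ.≤ᵇ⇒≤ 86 100 _) ⟩
    100 /10         ≈⟨ ⟋-cancel 10 9 ⟩
    fromℕ 10        ∎))

  sensed : ∀ ξ u {v} → v ∈ readSensor (engine ξ u) ŝₜ → ξ temp̂ +ᴿ -ᴿ ε ≤ v × v ≤ ξ temp̂ +ᴿ ε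
  sensed _ _ (ξ′ , (t-ε≤ , ≤t+ε) , v≈) =
    ≤-trans t-ε≤ (≤-reflexive (sym v≈)) , ≤-trans (≤-reflexive v≈) ≤t+ε

  enabled : ∀ {ξ u P} → Phase ξ u P → Enabled ξ u P
  enabled (sensing {ξ} {u} heat≡ t∈) = reading Ctrl-reads λ v∈ →
    deciding heat≡ t∈ (sensed ξ u v∈)
  enabled (deciding {ξ} {u} {v} heat≡ t∈ (t-ε≤v , v≤t+ε)) = decided (fromℕ 10 <? v)
    where
    decided : Dec (fromℕ 10 < v) → Enabled ξ u (decide (real v))
    -- The lower bound 99 comes from the reading, the upper bound 115 from the phase itself.
    decided (yes hot) = writing (decide-hot (dec-true (fromℕ 10 <? v) hot))
      (cooling₅ (heat-on (setCool u on) (setCool-cool u on))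
        (hot⇒ v≤t+ε (proj₁ hot) , upper t∈))
    -- Here the reading supplies the upper bound 101, and one heating step adds at most 14, which
    -- restores 115.
    decided (no cold) = waiting (decide-cold (dec-false (fromℕ 10 <? v) cold))
      (next-heated ξ u {m = 0} {n = 101} 0 115 (ℕ.≤ᵇ⇒≤ _ _ _) (ℕ.≤ᵇ⇒≤ _ _ _) heat≡
        (lower t∈ , cold⇒ t-ε≤v (≮⇒≥ cold)) (sensing heat≡))
  -- From `[99, 115]` one step leads to `[99 - 14, 115 - 6] = [85, 109]`, which is
  -- `[4 * 14 + 29, 4 * 6 + 85]`. Each further tick lowers `k` by one, down to `[29, 85]` at
  -- `k = 0`.
  enabled (cooling₅ {ξ} {u} heat≡ t∈) = waiting monitor-waits
    (next-cooled ξ u 85 109 (ℕ.≤ᵇ⇒≤ _ _ _) (ℕ.≤ᵇ⇒≤ _ _ _) heat≡ t∈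
      (cooling 4 (ℕ.≤ᵇ⇒≤ _ _ _) heat≡))
  enabled (cooling {ξ} {u} zero _ heat≡ t∈) = reading recheck-reads λ v∈ →
    rechecked t∈ (proj₂ (sensed ξ u v∈))
  enabled (cooling {ξ} {u} (suc k) k<4 heat≡ t∈) = waiting tick-waits
    (next-cooled ξ u (k ℕ.* 14 ℕ.+ 29) (k ℕ.* 6 ℕ.+ 85)
      (ℕ.≤-reflexive (14-cooler (k ℕ.* 14 ℕ.+ 29)))
      (ℕ.≤-reflexive (6-cooler (k ℕ.* 6 ℕ.+ 85)))
      heat≡ t∈ (cooling k (ℕ.<⇒≤ k<4) heat≡))
    where
    -- `suc k * 14 + 29` computes to `14 + (k * 14 + 29)`, so the bracket can be generalised to `n`;
    -- likewise with 6 below.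
    14-cooler : ∀ n → n ℕ.+ 4 ℕ.+ 10 ≡ 14 ℕ.+ n
    14-cooler = solve-∀
    6-cooler : ∀ n → 6 ℕ.+ n ℕ.+ 4 ≡ n ℕ.+ 10
    6-cooler = solve-∀
  -- The phase records no heating mode because this write sets it.
  enabled (rechecked {u = u} {v = v} t∈ v≤t+ε) = writing
    (decideAgain-cold (dec-false (fromℕ 10 <? v) (cooled⇒cold (upper t∈) v≤t+ε)))
    (resuming (heat-off (setCool u off) (setCool-cool u off))
      (∈-⊆ (ℕ.≤ᵇ⇒≤ _ _ _) (ℕ.≤ᵇ⇒≤ _ _ _) t∈))
  enabled (resuming {ξ} {u} heat≡ t∈) = waiting tick-waits
    (next-heated ξ u 0 115 (ℕ.≤ᵇ⇒≤ _ _ _) (ℕ.≤ᵇ⇒≤ _ _ _) heat≡ t∈ (sensing heat≡))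

  -- Invariant, guardedness and well-formedness in every phase.

  temperature-bounds : ∀ {ξ u P} → Phase ξ u P → ξ temp̂ ∈[ 0 , 300 ]
  temperature-bounds (sensing _ t∈)      = ∈-⊆ (ℕ.≤ᵇ⇒≤ _ _ _) (ℕ.≤ᵇ⇒≤ _ _ _) t∈
  temperature-bounds (deciding _ t∈ _)   = ∈-⊆ (ℕ.≤ᵇ⇒≤ _ _ _) (ℕ.≤ᵇ⇒≤ _ _ _) t∈
  temperature-bounds (cooling₅ _ t∈)     = ∈-⊆ (ℕ.≤ᵇ⇒≤ _ _ _) (ℕ.≤ᵇ⇒≤ _ _ _) t∈
  -- Since `k ≤ 4`, the upper bound is at most 109.
  temperature-bounds (cooling k k≤4 _ t∈) = ∈-⊆ ℕ.z≤n
    (ℕ.≤-trans (ℕ.+-monoˡ-≤ 85 (ℕ.*-monoˡ-≤ 6 k≤4)) (ℕ.≤ᵇ⇒≤ _ _ _)) t∈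
  temperature-bounds (rechecked t∈ _)    = ∈-⊆ (ℕ.≤ᵇ⇒≤ _ _ _) (ℕ.≤ᵇ⇒≤ _ _ _) t∈
  temperature-bounds (resuming _ t∈)     = ∈-⊆ (ℕ.≤ᵇ⇒≤ _ _ _) (ℕ.≤ᵇ⇒≤ _ _ _) t∈

  invariant-holds : ∀ {ξ u P} → Phase ξ u P → invariant (engine ξ u) ≡ true
  invariant-holds {ξ} phase with temperature-bounds phase
  ... | 0≤t , t≤30 = dec-true ((0# ≤? ξ temp̂) ×-dec (ξ temp̂ ≤? fromℕ 30))
    ( ≤-trans (⟋-nonNeg 0 9) 0≤t
    , ≤-trans t≤30 (≤-reflexive (⟋-cancel 30 9)) )

  -- For a variable `k` the predicate does not reduce on `tick^ k ∙ P`, hence the induction.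
  tick^-guardedFix : ∀ k {P : Proc 0 0} → GuardedFix P → GuardedFix (tick^ k ∙ P)
  tick^-guardedFix zero    g = g
  tick^-guardedFix (suc k) g = tick^-guardedFix k g

  guardedFix : ∀ {ξ u P} → Phase ξ u P → GuardedFix P
  guardedFix (sensing _ _)     = _
  guardedFix (deciding _ _ _)  = _
  guardedFix (cooling₅ _ _)    = _
  guardedFix (cooling k _ _ _) = tick^-guardedFix k _
  guardedFix (rechecked _ _)   = _
  guardedFix (resuming _ _)    = _

  EngineWellFormed : ∀ {k n} → Proc k n → Set
  EngineWellFormed = WellFormed ｛ temp ｝ ｛ cool ｝ ｛ sₜ ｝

  tick^-wellFormed : ∀ k {P : Proc 0 0} → EngineWellFormed P → EngineWellFormed (tick^ k ∙ P)
  tick^-wellFormed zero    w = w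
  tick^-wellFormed (suc k) w = tick^-wellFormed k w

  restart-wellFormed : EngineWellFormed {0} {0} restart
  restart-wellFormed = refl , CPS.wellFormed Eng , _

  monitor-wellFormed : EngineWellFormed monitor
  monitor-wellFormed = refl , (_ , restart-wellFormed) , _

  wellFormed : ∀ {ξ u P} → Phase ξ u P → EngineWellFormed P
  wellFormed (sensing _ _)     = CPS.wellFormed Eng
  wellFormed (deciding _ _ _)  = (refl , monitor-wellFormed , _) , CPS.wellFormed Eng
  wellFormed (cooling₅ _ _)    = monitor-wellFormed
  wellFormed (cooling k _ _ _) =
    tick^-wellFormed k (refl , ((_ , monitor-wellFormed , _) , restart-wellFormed) , _)
  wellFormed (rechecked _ _)   = (_ , monitor-wellFormed , _) , restart-wellFormed
  wellFormed (resuming _ _)    = CPS.wellFormed Eng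

  toCPS : ∀ {ξ u P} → Phase ξ u P → EngineCPS
  toCPS {ξ} {u} {P} phase = cps (engine ξ u) P (guardedFix phase) (wellFormed phase)

  -- Progress and preservation for safe engines.

  -- The proofs `g` and `w` are arbitrary because the transition rules let the target carry any such
  -- proofs.
  data Safe : EngineCPS → Set₁ where
    safe : ∀ {ξ u P g w} → Phase ξ u P → Safe (cps (engine ξ u) P g w)

  -- The error-free reading is always available, so a sensor read never blocks.
  readable : ∀ ξ u → ξ temp̂ ∈ readSensor (engine ξ u) ŝₜ
  readable ξ u = (λ _ → ξ temp̂) , (x≤z+y⇒x-y≤z t≤t+ε , t≤t+ε) , ≈-refl
    where
    t≤t+ε : ξ temp̂ ≤ ξ temp̂ +ᴿ ε
    t≤t+ε = x≤x+y (ξ temp̂) (⟋-nonNeg 1 9)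

  -- Taking the uncertainty `γ = 0#` gives a successor state, so time is never stopped by the
  -- environment.
  evolvable : ∀ ξ u → ∃ λ ξ′ → ξ′ ∈ evolutions ξ u
  evolvable ξ u = (λ _ → ξ temp̂ +ᴿ heat u +ᴿ 0#) ,
    0# , (nonNeg⇒-≤0 (⟋-nonNeg 4 9) , ⟋-nonNeg 4 9) , ≈-refl

  -- Used twice: as progress of a reader, and to refute a tick of a reader, whose rule demands that
  -- no τ-transition exist. `write-step` does the same for writers.
  read-step : ∀ {ξ u P K g w} → Phase ξ u P → Reader P K →
    (∀ {v} → v ∈ readSensor (engine ξ u) ŝₜ → Phase ξ u (K (real v))) →
    ∃ λ M → cps (engine ξ u) P g w =[ τ ]⇒ᵘ M
  read-step {ξ} {u} phase reader after = toCPS (after (readable ξ u)) ,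
    sensRead (invariant-holds phase) (untimed (Reader.step reader _)) refl (readable ξ u)

  write-step : ∀ {ξ u P r Q g w} → Phase ξ u P → Writer P r Q → Phase ξ (setCool u r) Q →
    ∃ λ M → cps (engine ξ u) P g w =[ τ ]⇒ᵘ M
  write-step phase writer after = toCPS after ,
    actWrite (invariant-holds phase) (untimed (Writer.step writer))

  -- Reduces the negative premise of `time` to the absence of untimed process transitions, which is
  -- `Waiter.quiet`.
  untimed-inversion : ∀ {M α M′} → _=[_]⇒ᵘ_ {｛ temp ｝} {｛ cool ｝} {｛ sₜ ｝} M α M′ →
                      ∃[ l ] ∃[ R ] CPS.proc M -[ l ]→ᵘ R
  untimed-inversion (outp _ (untimed p))         = _ , _ , p
  untimed-inversion (inpp _ (untimed p))         = _ , _ , p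
  untimed-inversion (sensRead _ (untimed p) _ _) = _ , _ , p
  untimed-inversion (actWrite _ (untimed p))     = _ , _ , p
  untimed-inversion (tau _ (untimed p))          = _ , _ , p

  progress : ∀ {M} → Safe M → ∃[ M′ ] ∃[ α ] (α ∈ ｛ τ ｝ ∪ ｛ tick ｝ × M =[ α ]⇒ M′)
  progress (safe {ξ} {u} phase) with enabled phase
  ... | reading reader after =
    let M′ , step = read-step phase reader after in M′ , τ , inj₁ refl , untimed step
  ... | writing writer after =
    let M′ , step = write-step phase writer after in M′ , τ , inj₁ refl , untimed step
  ... | waiting waiter after =
    let ξ′ , ξ′∈ = evolvable ξ u in
    toCPS (after ξ′∈) , tick , inj₂ refl ,
    time (invariant-holds phase) (timed (Waiter.step waiter))
      (λ _ step → Waiter.quiet waiter (proj₂ (proj₂ (untimed-inversion step))))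
      (ξ′ , ξ′∈ , refl)

  -- The `only` fields fix the label of each process transition, so communications clash with it. A
  -- tick of a reader or writer contradicts urgency, and a waiter can only tick.
  preservation : ∀ {M α M′} → Safe M → M =[ α ]⇒ M′ → α ∈ ｛ τ ｝ ∪ ｛ tick ｝ × Safe M′
  preservation (safe phase) step with enabled phase
  preservation (safe phase) (untimed (outp _ (untimed p)))           | reading reader after
    with _ , () , _ ← Reader.only reader p
  preservation (safe phase) (untimed (inpp _ (untimed p)))           | reading reader after
    with _ , () , _ ← Reader.only reader p
  -- Matching the membership proof with `refl` turns the sensor into `ŝₜ`, as `after` expects.
  preservation (safe phase) (untimed (sensRead _ (untimed p) refl v∈)) | reading reader after
    with _ , refl , refl ← Reader.only reader p = inj₁ refl , safe (after v∈)
  preservation (safe phase) (untimed (actWrite _ (untimed p)))       | reading reader after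
    with _ , () , _ ← Reader.only reader p
  preservation (safe phase) (untimed (tau _ (untimed p)))            | reading reader after
    with _ , () , _ ← Reader.only reader p
  preservation (safe phase) (time _ _ urgent _)                      | reading reader after =
    contradiction (proj₂ (read-step phase reader after)) (urgent _)
  preservation (safe phase) (untimed (outp _ (untimed p)))           | writing writer after
    with () , _ ← Writer.only writer p
  preservation (safe phase) (untimed (inpp _ (untimed p)))           | writing writer after
    with () , _ ← Writer.only writer p
  preservation (safe phase) (untimed (sensRead _ (untimed p) _ _))   | writing writer after
    with () , _ ← Writer.only writer p
  preservation (safe phase) (untimed (actWrite _ (untimed p)))       | writing writer after
    with refl , refl ← Writer.only writer p = inj₁ refl , safe after
  preservation (safe phase) (untimed (tau _ (untimed p)))            | writing writer after
    with () , _ ← Writer.only writer p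
  preservation (safe phase) (time _ _ urgent _)                      | writing writer after =
    contradiction (proj₂ (write-step phase writer after)) (urgent _)
  preservation (safe phase) (untimed step)                           | waiting waiter after =
    contradiction (proj₂ (proj₂ (untimed-inversion step))) (Waiter.quiet waiter)
  -- The type of `untimed` allows the label `tick`; `quiet` excludes it since it covers every label.
  preservation (safe phase) (time _ (untimed p) _ _)                 | waiting waiter after =
    contradiction p (Waiter.quiet waiter)
  preservation (safe phase) (time _ (timed p) _ (ξ′ , ξ′∈ , refl))   | waiting waiter after
    with refl ← Waiter.only waiter p = inj₂ refl , safe (after ξ′∈)

  run : ∀ {M αs M′} → Safe M → M =[ αs ]⇒* M′ → All (｛ τ ｝ ∪ ｛ tick ｝) αs × Safe M′
  run s []             = [] , s
  run s (step ∷ steps) =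
    let α∈ , s′  = preservation s step
        αs∈ , s″ = run s′ steps
    in α∈ ∷ αs∈ , s″

  Eng-safe : Safe Eng
  Eng-safe = safe (sensing (heat-off (λ _ → off) refl)
    (≤-reflexive (⟋-cancel 0 9) , ⟋-nonNeg 115 9))

proposition10 : (reals : Reals) (names : Names)
    (let open Calculus reals names)
    (temp : 𝒳) (cool : 𝒜) (sₜ : 𝒮) (warning : 𝒞) (ID : Value) (on off : ℝ) →
    on < 0# → 0# ≤ off →
    (let open Engine temp cool sₜ warning ID on off) →
    ∀ {αs Eng′} → Eng =[ αs ]⇒* Eng′ →
    All (｛ τ ｝ ∪ ｛ tick ｝) αs ×
    (∃[ Eng″ ] ∃[ α ] (α ∈ ｛ τ ｝ ∪ ｛ tick ｝ × Eng′ =[ α ]⇒ Eng″))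
proposition10 reals names temp cool sₜ warning ID on off on<0 0≤off steps =
  let αs∈ , s = run Eng-safe steps in αs∈ , progress s
  where
  open EngineSafety reals names temp cool sₜ warning ID on off on<0 0≤off
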